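{- Let $s\ge 3$ be an integer. Then $$T_s=B_0\cup B_1\cup\cdots\cup B_{\lfloor s/2\rfloor-1},\qquad B_k=\{1+k(s+2),\,2+k(s+2),\,\ldots,\,(k+1)s-1\},$$ and $T_s$ is a graded poset of length $\lfloor s/2\rfloor-1$ whose elements of rank $k$ are exactly those of $B_k$. Moreover, for $1\le k\le\lfloor s/2\rfloor-1$, each element $b\in B_k$ covers exactly the three elements $b-s,\ b-(s+1),\ b-(s+2)$, all of which lie in $B_{k-1}$ (and the elements of $B_0$ are exactly the minimal elements).
   Context: For a positive integer $s$, $T_s=P_{(s,s+1,s+2)}$ denotes the set of positive integers that cannot be written as $k_1s+k_2(s+1)+k_3(s+2)$ with $k_1,k_2,k_3$ nonnegative integers, partially ordered by: $y\ge x$ iff there exist $y=y_0,y_1,\ldots,y_l=x$, all in $T_s$, with $y_i-y_{i+1}\in\{s,s+1,s+2\}$ for all $i$. For a poset, $y$ covers $x$ if $x<y$ and there is no $z$ with $x<z<y$. -}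

module Defs where

open import Level using (Level; _⊔_; 0ℓ)
open import Data.Nat using (ℕ; suc; _+_; _*_; _∸_; _≤_; _<_)
open import Data.Nat.Properties using (≤-refl; ≤-trans; ≤-reflexive; ≤-antisym; m≤m+n)
open import Data.List using (List; length)
open import Data.List.Relation.Unary.Linked using (Linked)
import Data.List.Relation.Binary.Subset.Setoid as Subset
open import Data.Product using (_×_; ∃-syntax)
open import Data.Refinement using (Refinement-syntax; value)
open import Data.Refinement.Properties using (value-injective)
open import Data.Sum using (_⊎_; inj₁; inj₂)
open import Relation.Binary.Bundles using (Poset)
open import Relation.Binary.Construct.Closure.ReflexiveTransitive using (Star; ε; _◅_; _◅◅_)
import Relation.Binary.Properties.Poset as PosetProperties
open import Relation.Binary.PropositionalEquality using (_≡_; refl; sym; isEquivalence)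
open import Relation.Nullary using (¬_)
open import Relation.Unary using (Pred)

module _ {c ℓ₁ ℓ₂ : Level} (P : Poset c ℓ₁ ℓ₂) where
  open Poset P using (Carrier; _≈_; module Eq)
  open PosetProperties P using () renaming (_<_ to _≺_)
  open Subset Eq.setoid using (_⊆_)

  Minimal : Pred Carrier (c ⊔ ℓ₁ ⊔ ℓ₂)
  Minimal x = ∀ y → ¬ (y ≺ x)

  Covers : Carrier → Carrier → Set (c ⊔ ℓ₁ ⊔ ℓ₂)
  Covers y x = x ≺ y × ¬ (∃[ z ] (x ≺ z × z ≺ y))

  -- A finite chain is represented by its strictly increasing enumeration.
  IsChain : Pred (List Carrier) (c ⊔ ℓ₁ ⊔ ℓ₂)
  IsChain = Linked _≺_

  IsMaximalChain : Pred (List Carrier) (c ⊔ ℓ₁ ⊔ ℓ₂)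
  IsMaximalChain C = IsChain C × (∀ D → IsChain D → C ⊆ D → D ⊆ C)

  -- The length of a chain is its number of elements minus one, so a chain of
  -- length n is a list with suc n entries.
  HasLength : ℕ → Set (c ⊔ ℓ₁ ⊔ ℓ₂)
  HasLength n = (∃[ C ] (IsChain C × length C ≡ suc n))
              × (∀ C → IsChain C → length C ≤ suc n)

  -- For finite posets: all maximal chains have the same length, which is then
  -- the length of the poset.
  record IsGradedOfLength (n : ℕ) : Set (c ⊔ ℓ₁ ⊔ ℓ₂) where
    field
      hasLength     : HasLength n
      maximalChains : ∀ C → IsMaximalChain C → length C ≡ suc n

  -- On a finite graded poset there is exactly one such function.
  record IsRankFunction (ρ : Carrier → ℕ) : Set (c ⊔ ℓ₁ ⊔ ℓ₂) where
    field
      cong    : ∀ {x y} → x ≈ y → ρ x ≡ ρ y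
      minimal : ∀ {x} → Minimal x → ρ x ≡ 0
      covers  : ∀ {x y} → Covers y x → ρ y ≡ suc (ρ x)

T : ℕ → Pred ℕ 0ℓ
T s n = 0 < n
      × ¬ (∃[ k₁ ] ∃[ k₂ ] ∃[ k₃ ] n ≡ k₁ * s + k₂ * (s + 1) + k₃ * (s + 2))

B : ℕ → ℕ → Pred ℕ 0ℓ
B s k n = 1 + k * (s + 2) ≤ n × n ≤ (k + 1) * s ∸ 1

-- Membership proofs are irrelevant, so elements are equal as soon as their
-- values are.
TElement : ℕ → Set
TElement s = [ n ∈ ℕ ∣ T s n ]

Step : (s : ℕ) → TElement s → TElement s → Set
Step s y x = value y ≡ value x + s
           ⊎ value y ≡ value x + (s + 1)
           ⊎ value y ≡ value x + (s + 2)

Descends : (s : ℕ) → TElement s → TElement s → Set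
Descends s = Star (Step s)

private
  step⇒≤ : ∀ {s} {y x : TElement s} → Step s y x → value x ≤ value y
  step⇒≤ (inj₁ e)        = ≤-trans (m≤m+n _ _) (≤-reflexive (sym e))
  step⇒≤ (inj₂ (inj₁ e)) = ≤-trans (m≤m+n _ _) (≤-reflexive (sym e))
  step⇒≤ (inj₂ (inj₂ e)) = ≤-trans (m≤m+n _ _) (≤-reflexive (sym e))

  descends⇒≤ : ∀ {s} {y x : TElement s} → Descends s y x → value x ≤ value y
  descends⇒≤ ε                        = ≤-refl
  descends⇒≤ {s} (_◅_ {y} {z} st sts) = ≤-trans (descends⇒≤ sts) (step⇒≤ {s} {y} {z} st)

TPoset : ℕ → Poset 0ℓ 0ℓ 0ℓ
TPoset s = record
  { Carrier        = TElement s
  ; _≈_            = _≡_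
  ; _≤_            = λ x y → Descends s y x
  ; isPartialOrder = record
    { isPreorder = record
      { isEquivalence = isEquivalence
      ; reflexive     = λ { refl → ε }
      ; trans         = λ x≤y y≤z → y≤z ◅◅ x≤y
      }
    ; antisym = λ x≤y y≤x → value-injective (≤-antisym (descends⇒≤ x≤y) (descends⇒≤ y≤x))
    }
  }

{-# OPTIONS --safe #-}

-- The sums of exactly m generators fill the interval [m s, m (s + 2)], so T_s is
-- the union of the gaps between consecutive such intervals, and the k-th gap is
-- B_k.  Subtracting a generator sends B_(k+1) into B_k, and no step inside T_s can
-- change k by anything but one, so k is a rank for which the steps are exactly the
-- cover relations.  Every element of B_k with k not maximal is below one of
-- B_(k+1); hence every chain refines to one that meets all ranks.
module Submission where

open import Defs
open import Data.Empty using (⊥-elim)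
open import Data.Fin using (Fin; toℕ; fromℕ<)
open import Data.Fin.Properties using (toℕ-injective; toℕ-fromℕ<; toℕ≤pred[n]; injective⇒≤)
open import Data.Irrelevant using ([_])
open import Data.List using (List; []; _∷_; length; lookup)
open import Data.List.Membership.Propositional using (find; lose)
open import Data.List.Relation.Binary.Subset.Propositional using (_⊆_)
open import Data.List.Relation.Unary.Any using (Any; here; there; index)
open import Data.List.Relation.Unary.Any.Properties using (lookup-index)
open import Data.List.Relation.Unary.Linked using ([]; [-]; _∷_)
open import Data.Nat using (ℕ; zero; suc; _+_; _*_; _∸_; _≤_; _<_; z≤n; s≤s; s≤s⁻¹; ⌊_/2⌋; NonZero; >-nonZero; _<?_)
open import Data.Nat.DivMod using (_/_; _%_; m≡m%n+[m/n]*n; m%n<n)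
open import Data.Nat.Properties
open import Data.Nat.Tactic.RingSolver using (solve-∀)
open import Data.Product using (_×_; _,_; ∃-syntax)
open import Data.Refinement using (value; _,_)
open import Data.Sum using (_⊎_; inj₁; inj₂)
open import Function using (_∘_; id)
open import Function.Bundles using (_⇔_; mk⇔; Equivalence)
open import Relation.Binary.Construct.Closure.ReflexiveTransitive using (ε; _◅_)
open import Relation.Binary.PropositionalEquality using (_≡_; refl; sym; trans; cong; subst)
import Relation.Binary.Properties.Poset as PosetProperties
open import Relation.Nullary using (¬_; Dec; yes; no)
open import Relation.Nullary.Decidable using (recompute; map′; _×-dec_)
open import Relation.Unary using (_∈_; _≐_; ⋃)

-- Sums of generators as a union of intervals

Representable : ℕ → ℕ → Set
Representable s n = ∃[ k₁ ] ∃[ k₂ ] ∃[ k₃ ] n ≡ k₁ * s + k₂ * (s + 1) + k₃ * (s + 2)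

-- Start from `m` copies of `s`: trading one for `s + 2` absorbs two units of the offset, and a last
-- odd unit is absorbed by one `s + 1`.
representable-offset : ∀ s m d → d ≤ m * 2 → Representable s (m * s + d)
representable-offset s m zero _ = m , 0 , 0 , sym (+-identityʳ (m * s + 0))
representable-offset s (suc m) (suc zero) _ = m , 1 , 0 , eq s m
  where
  eq : ∀ s m → (s + m * s) + 1 ≡ m * s + 1 * (s + 1) + 0
  eq = solve-∀
representable-offset s (suc m) (suc (suc d)) (s≤s (s≤s d≤2m))
  with k₁ , k₂ , k₃ , e ← representable-offset s m d d≤2m
  = k₁ , k₂ , suc k₃ , trans (left s (m * s) d) (trans (cong (_+ (s + 2)) e) (right (k₁ * s + k₂ * (s + 1)) (k₃ * (s + 2)) s))
  where
  left : ∀ s x d → (s + x) + suc (suc d) ≡ (x + d) + (s + 2)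
  left = solve-∀
  right : ∀ x y s → (x + y) + (s + 2) ≡ x + ((s + 2) + y)
  right = solve-∀

representable-interval : ∀ s m n → m * s ≤ n → n ≤ m * (s + 2) → Representable s n
representable-interval s m n lo hi = subst (Representable s) (m+[n∸m]≡n lo)
  (representable-offset s m (n ∸ m * s)
    (≤-trans (∸-monoˡ-≤ (m * s) hi) (≤-reflexive (trans (cong (_∸ m * s) (*-distribˡ-+ m s 2)) (m+n∸m≡n (m * s) (m * 2))))))

representable⇒interval : ∀ s n → Representable s n → ∃[ m ] (m * s ≤ n × n ≤ m * (s + 2))
-- The witness is the number of generators used; each lies between `s` and `s + 2`.
representable⇒interval s _ (k₁ , k₂ , k₃ , refl) = k₁ + k₂ + k₃
  , ≤-trans (m≤m+n _ _) (≤-reflexive (lo s k₁ k₂ k₃))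
  , ≤-trans (m≤m+n _ _) (≤-reflexive (hi s k₁ k₂ k₃))
  where
  lo : ∀ s a b c → (a + b + c) * s + (b + c * 2) ≡ a * s + b * (s + 1) + c * (s + 2)
  lo = solve-∀
  hi : ∀ s a b c → a * s + b * (s + 1) + c * (s + 2) + (a * 2 + b) ≡ (a + b + c) * (s + 2)
  hi = solve-∀

-- The gaps between consecutive intervals

-- B s k with its upper end written without truncated subtraction.
record Gap (s k n : ℕ) : Set where
  constructor between
  field
    lower : k * (s + 2) < n
    upper : n < suc k * s

Gap? : ∀ s k n → Dec (Gap s k n)
Gap? s k n = map′ (λ (lo , hi) → between lo hi) (λ (between lo hi) → lo , hi)
  ((k * (s + 2) <? n) ×-dec (n <? suc k * s))

B⇒Gap : ∀ {s k n} → B s k n → Gap s k n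
B⇒Gap {s} {k} {suc n} (lo , hi) = between lo (subst (λ m → suc n < m * s) (+-comm k 1) (m≤n∸1⇒m<n hi))
  where
  m≤n∸1⇒m<n : ∀ {m n} → suc m ≤ n ∸ 1 → suc m < n
  m≤n∸1⇒m<n {n = suc n} le = s≤s le

Gap⇒B : ∀ {s k n} → Gap s k n → B s k n
Gap⇒B {s} {k} {n} (between lo hi) = lo , ∸-monoˡ-≤ 1 (subst (λ m → n < m * s) (+-comm 1 k) hi)

Gap⇒T : ∀ {s k n} → Gap s k n → T s n
Gap⇒T {s} {k} {n} (between lo hi) = ≤-trans (s≤s z≤n) lo , not-representable
  where
  not-representable : ¬ Representable s n
  -- A sum of `m` generators inside the gap would force `k < m` at the lower end and `m < suc k` at
  -- the upper end.
  not-representable rep with m , ms≤n , n≤ms+2 ← representable⇒interval s n rep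
    = <⇒≱ (*-cancelʳ-< (s + 2) k m (<-≤-trans lo n≤ms+2)) (s≤s⁻¹ (*-cancelʳ-< s m (suc k) (≤-<-trans ms≤n hi)))

Gap-unique : ∀ {s j k n} → Gap s j n → Gap s k n → j ≡ k
Gap-unique g h = ≤-antisym (le g h) (le h g)
  where
  le : ∀ {s j k n} → Gap s j n → Gap s k n → j ≤ k
  le {s} {j} {k} (between lo _) (between _ hi) =
    s≤s⁻¹ (*-cancelʳ-< s j (suc k) (≤-<-trans (*-monoʳ-≤ j (m≤m+n s 2)) (<-trans lo hi)))

-- Two strict inequalities give `k * (s + 2) + 2 ≤ suc k * s`, where `k * s` cancels. This limits
-- the number of nonempty gaps.
Gap-bound : ∀ {s k n} → Gap s k n → suc k * 2 ≤ s
Gap-bound {s} {k} (between lo hi) =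
  +-cancelʳ-≤ (k * s) _ _ (≤-trans (≤-reflexive (eq k s)) (≤-trans (s≤s lo) hi))
  where
  eq : ∀ k s → suc k * 2 + k * s ≡ suc (suc (k * (s + 2)))
  eq = solve-∀

private
  double : ∀ m → m * 2 ≡ m + m
  double = solve-∀

m*2≤n⇒m≤⌊n/2⌋ : ∀ {m n} → m * 2 ≤ n → m ≤ ⌊ n /2⌋
m*2≤n⇒m≤⌊n/2⌋ {m} {n} le = subst (_≤ ⌊ n /2⌋) (sym (n≡⌊n+n/2⌋ m)) (⌊n/2⌋-mono (subst (_≤ n) (double m) le))

m≤⌊n/2⌋⇒m*2≤n : ∀ {m n} → m ≤ ⌊ n /2⌋ → m * 2 ≤ n
m≤⌊n/2⌋⇒m*2≤n {m} {n} le = ≤-trans (≤-reflexive (double m))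
  (≤-trans (+-mono-≤ le (≤-trans le (⌊n/2⌋≤⌈n/2⌉ n))) (≤-reflexive (⌊n/2⌋+⌈n/2⌉≡n n)))

-- Moving between consecutive gaps

-- A step raises the gap index by at least one because it adds at least s and by at
-- most one because it adds at most s + 2.
Gap-step : ∀ {s j k n i} → i ≤ 2 → Gap s j n → Gap s k (n + (s + i)) → k ≡ suc j
Gap-step {s} {j} {k} {n} {i} i≤2 (between jlo jhi) (between klo khi) = ≤-antisym
  (s≤s⁻¹ (*-cancelʳ-< (s + 2) k (2 + j) (<-trans klo
    (<-≤-trans (+-monoˡ-< (s + i) jhi) (≤-trans (+-mono-≤ (*-monoʳ-≤ (suc j) (m≤m+n s 2)) (+-monoʳ-≤ s i≤2)) (≤-reflexive (+-comm (suc j * (s + 2)) (s + 2))))))))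
  (s≤s⁻¹ (*-cancelʳ-< s (suc j) (suc k) (≤-<-trans
    (≤-trans (≤-reflexive (+-comm s (j * s))) (+-mono-≤ (≤-trans (*-monoʳ-≤ j (m≤m+n s 2)) (<⇒≤ jlo)) (m≤m+n s i))) khi)))

Gap-suc⇒≤ : ∀ {s j n i} → i ≤ 2 → Gap s (suc j) n → s + i ≤ n
Gap-suc⇒≤ {s} i≤2 (between lo _) = ≤-trans (+-monoʳ-≤ s i≤2) (≤-trans (m≤m+n (s + 2) _) (<⇒≤ lo))

-- From one gap to the previous one the lower end drops by `s + 2` and the upper end by `s`; the
-- amount `s + i` lies between the two.
Gap-down : ∀ {s j n i} → i ≤ 2 → Gap s (suc j) n → Gap s j (n ∸ (s + i))
Gap-down {s} {j} {n} {i} i≤2 g@(between lo hi) = between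
  (m+n≤o⇒m≤o∸n (suc (j * (s + 2))) (≤-trans
      (≤-trans (+-monoʳ-≤ (suc (j * (s + 2))) (+-monoʳ-≤ s i≤2)) (≤-reflexive (cong suc (+-comm (j * (s + 2)) (s + 2))))) lo))
  (+-cancelʳ-< (s + i) _ _ (<-≤-trans
      (subst (_< s + suc j * s) (sym (m∸n+n≡m (Gap-suc⇒≤ i≤2 g))) hi)
      (≤-trans (≤-reflexive (+-comm s (suc j * s))) (+-monoʳ-≤ (suc j * s) (m≤m+n s i)))))

-- Take the least `i` for which the sum clears the lower end; `i = 2` always does. For `i > 0`
-- minimality puts the sum at most one above `suc j * (s + 2)`, and `bound` is exactly what keeps
-- that below the upper end.
Gap-up : ∀ {s j n} → (2 + j) * 2 ≤ s → Gap s j n → ∃[ i ] (i ≤ 2 × Gap s (suc j) (n + (s + i)))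
Gap-up {s} {j} {n} bound (between lo hi) = first-in-gap
  where
  shift : ∀ n s i → n + (s + suc i) ≡ suc (n + (s + i))
  shift = solve-∀
  width : ∀ j s → suc (suc (suc j * (s + 2))) ≡ (2 + j) * 2 + suc j * s
  width = solve-∀
  below-top : ∀ i → n + (s + i) ≤ suc j * (s + 2) → n + (s + suc i) < (2 + j) * s
  below-top i le = ≤-trans (s≤s (≤-trans (≤-reflexive (shift n s i)) (s≤s le)))
    (≤-trans (≤-reflexive (width j s)) (+-monoˡ-≤ (suc j * s) bound))
  first-in-gap : ∃[ i ] (i ≤ 2 × Gap s (suc j) (n + (s + i)))
  first-in-gap with suc j * (s + 2) <? n + (s + 0) | suc j * (s + 2) <? n + (s + 1)
  ... | yes lo₀ | _ = 0 , z≤n , between lo₀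
    (subst (n + (s + 0) <_) (+-comm (suc j * s) s) (+-mono-<-≤ hi (≤-reflexive (+-identityʳ s))))
  ... | no ¬lo₀ | yes lo₁ = 1 , s≤s z≤n , between lo₁ (below-top 0 (≮⇒≥ ¬lo₀))
  ... | no _ | no ¬lo₁ = 2 , ≤-refl , between
    (subst (_< n + (s + 2)) (+-comm (j * (s + 2)) (s + 2)) (+-monoˡ-< (s + 2) lo))
    (below-top 1 (≮⇒≥ ¬lo₁))

-- Pigeonhole: entries with different values of `f` occupy different positions.
values-below⇒≤length : ∀ {A : Set} (f : A → ℕ) (xs : List A) n →
  (∀ k → k ≤ n → Any (λ x → f x ≡ k) xs) → suc n ≤ length xs
values-below⇒≤length f xs n hit = injective⇒≤ {f = position} position-injective
  where
  hit′ : (k : Fin (suc n)) → Any (λ x → f x ≡ toℕ k) xs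
  hit′ k = hit (toℕ k) (toℕ≤pred[n] k)
  position : Fin (suc n) → Fin (length xs)
  position k = index (hit′ k)
  position-injective : ∀ {j k} → position j ≡ position k → j ≡ k
  position-injective {j} {k} e = toℕ-injective
    (trans (sym (lookup-index (hit′ j))) (trans (cong (f ∘ lookup xs) e) (lookup-index (hit′ k))))

-- The rank function, and steps as cover relations

module _ (s : ℕ) where

  private
    instance
      s+2≢0 : NonZero (s + 2)
      s+2≢0 = >-nonZero (≤-trans (s≤s z≤n) (m≤n+m 2 s))

  open PosetProperties (TPoset s) using () renaming (_<_ to _≺_)

  -- The quotient `k` satisfies `k * (s + 2) ≤ n < suc k * (s + 2)`. Failing the lower bound of the
  -- gap would put `n` in the interval of sums of `k` generators, failing the upper one in that of
  -- `suc k` generators.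
  T⇒Gap : ∀ {n} → T s n → Gap s (n / (s + 2)) n
  T⇒Gap {n} (_ , ¬rep) = between (≰⇒> not-below) (≰⇒> not-above)
    where
    k = n / (s + 2)
    n≡ : n ≡ n % (s + 2) + k * (s + 2)
    n≡ = m≡m%n+[m/n]*n n (s + 2)
    not-below : ¬ (n ≤ k * (s + 2))
    not-below le = ¬rep (representable-interval s k n
      (≤-trans (*-monoʳ-≤ k (m≤m+n s 2)) (≤-trans (m≤n+m _ _) (≤-reflexive (sym n≡)))) le)
    not-above : ¬ (suc k * s ≤ n)
    not-above le = ¬rep (representable-interval s (suc k) n le
      (≤-trans (≤-reflexive n≡) (+-monoˡ-≤ (k * (s + 2)) (<⇒≤ (m%n<n n (s + 2))))))

  rank : TElement s → ℕ
  rank x = value x / (s + 2)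

  -- Membership in T is stored irrelevantly, but Gap is decidable and so recoverable.
  rank-Gap : ∀ x → Gap s (rank x) (value x)
  rank-Gap (n , [ n∈T ]) = recompute (Gap? s (n / (s + 2)) n) (T⇒Gap n∈T)

  Gap⇒rank≡ : ∀ {k} x → Gap s k (value x) → rank x ≡ k
  Gap⇒rank≡ x g = Gap-unique (rank-Gap x) g

  rank≡⇒Gap : ∀ {k} x → rank x ≡ k → Gap s k (value x)
  rank≡⇒Gap x refl = rank-Gap x

  element : ∀ {k n} → Gap s k n → TElement s
  element {n = n} g = n , [ Gap⇒T g ]

  offset⇒Step : ∀ {y x i} → i ≤ 2 → value y ≡ value x + (s + i) → Step s y x
  offset⇒Step z≤n             e = inj₁ (trans e (cong (_ +_) (+-identityʳ s)))
  offset⇒Step (s≤s z≤n)       e = inj₂ (inj₁ e)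
  offset⇒Step (s≤s (s≤s z≤n)) e = inj₂ (inj₂ e)

  Step⇒offset : ∀ {y x} → Step s y x → ∃[ i ] (i ≤ 2 × value y ≡ value x + (s + i))
  Step⇒offset (inj₁ e)        = 0 , z≤n , trans e (cong (_ +_) (sym (+-identityʳ s)))
  Step⇒offset (inj₂ (inj₁ e)) = 1 , s≤s z≤n , e
  Step⇒offset (inj₂ (inj₂ e)) = 2 , ≤-refl , e

  rank-Step : ∀ {y x} → Step s y x → rank y ≡ suc (rank x)
  rank-Step {y} {x} st with i , i≤2 , e ← Step⇒offset {y} {x} st
    = Gap-step i≤2 (rank-Gap x) (subst (Gap s (rank y)) e (rank-Gap y))

  rank-Descends : ∀ {y x} → Descends s y x → rank x ≤ rank y
  rank-Descends ε = ≤-refl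
  rank-Descends (_◅_ {y} {z} st sts) =
    ≤-trans (rank-Descends sts) (≤-trans (n≤1+n _) (≤-reflexive (sym (rank-Step {y} {z} st))))

  rank-≺ : ∀ {x y} → x ≺ y → rank x < rank y
  rank-≺ (ε , x≢x) = ⊥-elim (x≢x refl)
  rank-≺ (_◅_ {y} {z} st sts , _) =
    ≤-trans (s≤s (rank-Descends sts)) (≤-reflexive (sym (rank-Step {y} {z} st)))

  Step⇒≺ : ∀ {y x} → Step s y x → x ≺ y
  Step⇒≺ {y} {x} st = st ◅ ε , λ { refl → 1+n≢n (sym (rank-Step {y} {x} st)) }

  -- An element strictly between would need two rank increases, while a step makes only one.
  Step⇒Covers : ∀ {y x} → Step s y x → Covers (TPoset s) y x
  Step⇒Covers {y} {x} st = Step⇒≺ st , λ (z , x≺z , z≺y) →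
    <⇒≱ (≤-<-trans (rank-≺ x≺z) (rank-≺ z≺y)) (≤-reflexive (rank-Step {y} {x} st))

  Covers⇒Step : ∀ {y x} → Covers (TPoset s) y x → Step s y x
  Covers⇒Step ((ε , x≢x) , _) = ⊥-elim (x≢x refl)
  Covers⇒Step ((st ◅ ε , _) , _) = st
  -- A path of at least two steps passes through `z`, which lies strictly between `x` and `y`
  -- because rank drops along the rest of the path.
  Covers⇒Step {y} {x} ((_◅_ {j = z} st (_◅_ {j = w} st′ sts) , _) , none) =
    ⊥-elim (none (z , (st′ ◅ sts , x≢z) , Step⇒≺ st))
    where
    x≢z : ¬ (x ≡ z)
    x≢z refl = <⇒≱ (≤-reflexive (sym (rank-Step {z} {w} st′))) (rank-Descends sts)

  Step-down : ∀ {j} y → rank y ≡ suc j → ∃[ x ] (rank x ≡ j × Step s y x)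
  Step-down y e = element g , Gap⇒rank≡ (element g) g
    , offset⇒Step {y} {element g} {2} ≤-refl (sym (m∸n+n≡m (Gap-suc⇒≤ {i = 2} ≤-refl h)))
    where
    h = rank≡⇒Gap y e
    g = Gap-down {i = 2} ≤-refl h

  Step-up : ∀ x → (2 + rank x) * 2 ≤ s → ∃[ y ] Step s y x
  Step-up x bound with i , i≤2 , g ← Gap-up bound (rank-Gap x)
    = element g , offset⇒Step {element g} {x} i≤2 refl

  Minimal⇒rank≡0 : ∀ x → Minimal (TPoset s) x → rank x ≡ 0
  Minimal⇒rank≡0 x min with rank x in e
  ... | zero  = refl
  ... | suc j with z , _ , st ← Step-down x e = ⊥-elim (min z (Step⇒≺ st))

  rank≡0⇒Minimal : ∀ x → rank x ≡ 0 → Minimal (TPoset s) x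
  rank≡0⇒Minimal x e y y≺x = n≮0 (subst (rank y <_) e (rank-≺ y≺x))

  rank-isRankFunction : IsRankFunction (TPoset s) rank
  rank-isRankFunction = record
    { cong    = cong rank
    ; minimal = Minimal⇒rank≡0 _
    ; covers  = λ {x} {y} c → rank-Step {y} {x} (Covers⇒Step c)
    }

  Step⇔∸ : ∀ {j} b → Gap s (suc j) (value b) → ∀ x →
    Step s b x ⇔ (value x ≡ value b ∸ s ⊎ value x ≡ value b ∸ (s + 1) ⊎ value x ≡ value b ∸ (s + 2))
  Step⇔∸ b g x = mk⇔
    (λ { (inj₁ e)        → inj₁ (to e)
       ; (inj₂ (inj₁ e)) → inj₂ (inj₁ (to e))
       ; (inj₂ (inj₂ e)) → inj₂ (inj₂ (to e)) })
    -- Values in gap `suc j` are at least `s + 2`, so none of the subtractions truncates.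
    (λ { (inj₁ e)        → inj₁ (from (≤-trans (m≤m+n s 0) (Gap-suc⇒≤ z≤n g)) e)
       ; (inj₂ (inj₁ e)) → inj₂ (inj₁ (from (Gap-suc⇒≤ (s≤s z≤n) g) e))
       ; (inj₂ (inj₂ e)) → inj₂ (inj₂ (from (Gap-suc⇒≤ ≤-refl g) e)) })
    where
    to : ∀ {d} → value b ≡ value x + d → value x ≡ value b ∸ d
    to {d} e = sym (trans (cong (_∸ d) e) (m+n∸n≡m (value x) d))
    from : ∀ {d} → d ≤ value b → value x ≡ value b ∸ d → value b ≡ value x + d
    from {d} d≤b e = sym (trans (cong (_+ d) e) (m∸n+n≡m d≤b))

  -- Completing chains, and gradedness

  module _ (3≤s : 3 ≤ s) where

    private
      n = ⌊ s /2⌋ ∸ 1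

      1+n≡⌊s/2⌋ : suc n ≡ ⌊ s /2⌋
      1+n≡⌊s/2⌋ = m+[n∸m]≡n (⌊n/2⌋-mono 3≤s)

    rank≤n : ∀ x → rank x ≤ n
    rank≤n x = ∸-monoˡ-≤ 1 (m*2≤n⇒m≤⌊n/2⌋ (Gap-bound (rank-Gap x)))

    chain-length : ∀ C → IsChain (TPoset s) C → length C ≤ suc n
    chain-length [] _ = z≤n
    chain-length (x ∷ C) ch = ≤-trans (m≤n+m _ (rank x)) (bound x C ch)
      where
      -- Each further entry costs at least one rank, and ranks stop at `n`.
      bound : ∀ x C → IsChain (TPoset s) (x ∷ C) → rank x + suc (length C) ≤ suc n
      bound x [] _ = subst (_≤ suc n) (+-comm 1 (rank x)) (s≤s (rank≤n x))
      bound x (y ∷ C) (x≺y ∷ ch) = ≤-trans (≤-reflexive (+-suc (rank x) (suc (length C))))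
        (≤-trans (+-monoˡ-≤ (suc (length C)) (rank-≺ x≺y)) (bound y C ch))

    -- The least entry `x` is kept apart because chains are extended downwards, at the head; only
    -- ranks from that of `x` up to `n` are required.
    Saturated : TElement s → List (TElement s) → Set
    Saturated x xs = IsChain (TPoset s) (x ∷ xs)
      × (∀ k → rank x ≤ k → k ≤ n → Any (λ z → rank z ≡ k) (x ∷ xs))

    Saturated-∷ : ∀ {x y ys} → Step s y x → Saturated y ys → Saturated x (y ∷ ys)
    Saturated-∷ {x} {y} st (ch , hit) = Step⇒≺ st ∷ ch , hit′
      where
      hit′ : ∀ k → rank x ≤ k → k ≤ n → Any (λ z → rank z ≡ k) (x ∷ y ∷ _)
      hit′ k x≤k k≤n with m≤n⇒m<n∨m≡n x≤k
      ... | inj₁ x<k = there (hit k (≤-trans (≤-reflexive (rank-Step {y} {x} st)) x<k) k≤n)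
      ... | inj₂ x≡k = here x≡k

    Saturated-extend : ∀ {x y ys} → Descends s y x → Saturated y ys →
      ∃[ xs ] (Saturated x xs × y ∷ ys ⊆ x ∷ xs)
    Saturated-extend {ys = ys} ε sat = ys , sat , id
    Saturated-extend (st ◅ sts) sat =
      let xs , sat′ , sub = Saturated-extend sts (Saturated-∷ st sat) in
      xs , sat′ , λ m → sub (there m)

    -- Climb one rank at a time with `Step-up`; the recursion is on the number of ranks left below
    -- `n`.
    Saturated-above : ∀ x → ∃[ xs ] Saturated x xs
    Saturated-above x = go (n ∸ rank x) x (m∸n+n≡m (rank≤n x))
      where
      go : ∀ d x → d + rank x ≡ n → ∃[ xs ] Saturated x xs
      go zero x e = [] , [-] , λ k x≤k k≤n → here (≤-antisym x≤k (≤-trans k≤n (≤-reflexive (sym e))))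
      go (suc d) x e = prepend (Step-up x (m≤⌊n/2⌋⇒m*2≤n room))
        where
        room : 2 + rank x ≤ ⌊ s /2⌋
        room = ≤-trans (s≤s (≤-trans (s≤s (m≤n+m (rank x) d)) (≤-reflexive e))) (≤-reflexive 1+n≡⌊s/2⌋)
        prepend : ∃[ y ] Step s y x → ∃[ xs ] Saturated x xs
        prepend (y , st) =
          let ys , sat = go d y (trans (cong (d +_) (rank-Step {y} {x} st)) (trans (+-suc d (rank x)) e))
          in y ∷ ys , Saturated-∷ st sat

    descend-to-0 : ∀ k x → rank x ≡ k → ∃[ y ] (rank y ≡ 0 × Descends s x y)
    descend-to-0 zero x e = x , e , ε
    descend-to-0 (suc k) x e =
      let y , ey , st = Step-down x e
          z , ez , sts = descend-to-0 k y ey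
      in z , ez , st ◅ sts

    -- Works from the top of the chain down: saturate above the last entry, then insert between
    -- neighbours the path that witnesses their comparison.
    chain⊆saturated : ∀ x C → IsChain (TPoset s) (x ∷ C) → ∃[ xs ] (Saturated x xs × x ∷ C ⊆ x ∷ xs)
    chain⊆saturated x [] _ =
      let xs , sat = Saturated-above x in
      xs , sat , λ { (here e) → here e }
    chain⊆saturated x (y ∷ C) ((x≤y , _) ∷ ch) =
      let ys , sat , sub = chain⊆saturated y C ch
          xs , sat′ , sub′ = Saturated-extend x≤y sat
      in xs , sat′ , λ { (here e) → here e ; (there m) → sub′ (sub m) }

    one : TElement s
    one = element {0} {1} (between (s≤s z≤n) (≤-trans (≤-trans (s≤s (s≤s z≤n)) 3≤s) (m≤m+n s 0)))

    complete-chain : ∀ C → IsChain (TPoset s) C →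
      ∃[ D ] (IsChain (TPoset s) D × C ⊆ D × (∀ k → k ≤ n → Any (λ z → rank z ≡ k) D))
    -- The empty chain offers no entry to extend from, so the element 1 of rank 0 is used instead.
    complete-chain [] _ =
      let D , ch , _ , hit = complete-chain (one ∷ []) [-] in D , ch , (λ ()) , hit
    complete-chain (x ∷ C) ch =
      let xs , sat , sub = chain⊆saturated x C ch
          y , ey , x≥y = descend-to-0 (rank x) x refl
          ys , (ch′ , hit) , sub′ = Saturated-extend x≥y sat
      in y ∷ ys , ch′ , sub′ ∘ sub , λ k → hit k (≤-trans (≤-reflexive ey) z≤n)

    chain-hitting-all-ranks : ∀ C → IsChain (TPoset s) C →
      (∀ k → k ≤ n → Any (λ z → rank z ≡ k) C) → length C ≡ suc n
    chain-hitting-all-ranks C ch hit = ≤-antisym (chain-length C ch) (values-below⇒≤length rank C n hit)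

    isGraded : IsGradedOfLength (TPoset s) n
    isGraded = record
      { hasLength     = longest , chain-length
      ; maximalChains = maximal
      }
      where
      longest : ∃[ C ] (IsChain (TPoset s) C × length C ≡ suc n)
      longest = let D , ch , _ , hit = complete-chain [] [] in D , ch , chain-hitting-all-ranks D ch hit
      maximal : ∀ C → IsMaximalChain (TPoset s) C → length C ≡ suc n
      -- Maximality forces the completion `D` back into `C`, so `C` itself meets every rank.
      maximal C (ch , max) = chain-hitting-all-ranks C ch λ k k≤n →
        let D , ch′ , C⊆D , hit = complete-chain C ch
            _ , z∈D , e = find (hit k k≤n)
        in lose (max D ch′ C⊆D z∈D) e

    T≐⋃B : T s ≐ ⋃ (Fin ⌊ s /2⌋) (λ k → B s (toℕ k))
    T≐⋃B = T⇒B , λ (k , b) → Gap⇒T (B⇒Gap {k = toℕ k} b)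
      where
      T⇒B : ∀ {m} → T s m → ∃[ k ] B s (toℕ {⌊ s /2⌋} k) m
      T⇒B {m} t = fromℕ< k< , subst (λ k → B s k m) (sym (toℕ-fromℕ< k<)) (Gap⇒B g)
        where
        g  = T⇒Gap t
        k< = m*2≤n⇒m≤⌊n/2⌋ {suc (m / (s + 2))} (Gap-bound g)

theorem2p3 : (s : ℕ) → 3 ≤ s →
    (T s ≐ ⋃ (Fin ⌊ s /2⌋) (λ k → B s (toℕ k)))
    × IsGradedOfLength (TPoset s) (⌊ s /2⌋ ∸ 1)
    × (∃[ ρ ] (IsRankFunction (TPoset s) ρ
    × (∀ k → k ≤ ⌊ s /2⌋ ∸ 1 → ∀ x → (ρ x ≡ k) ⇔ (value x ∈ B s k))))
    × (∀ k → 1 ≤ k → k ≤ ⌊ s /2⌋ ∸ 1 → ∀ b → value b ∈ B s k →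
    (∀ x → Covers (TPoset s) b x ⇔
    ( value x ≡ value b ∸ s
    ⊎ value x ≡ value b ∸ (s + 1)
    ⊎ value x ≡ value b ∸ (s + 2)))
    × (value b ∸ s ∈ B s (k ∸ 1))
    × (value b ∸ (s + 1) ∈ B s (k ∸ 1))
    × (value b ∸ (s + 2) ∈ B s (k ∸ 1)))
    × (∀ x → (value x ∈ B s 0) ⇔ Minimal (TPoset s) x)
theorem2p3 s 3≤s =
    T≐⋃B s 3≤s
  , isGraded s 3≤s
  , (rank s , rank-isRankFunction s , λ k _ x →
      mk⇔ (Gap⇒B ∘ rank≡⇒Gap s x) (Gap⇒rank≡ s x ∘ B⇒Gap {k = k}))
  , (λ { (suc j) _ _ b b∈B → let g = B⇒Gap {k = suc j} b∈B in
         (λ x → let open Equivalence (Step⇔∸ s b g x) in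
           mk⇔ (to ∘ Covers⇒Step s) (Step⇒Covers s ∘ from))
       , subst (λ d → value b ∸ d ∈ B s j) (+-identityʳ s) (Gap⇒B (Gap-down {i = 0} z≤n g))
       , Gap⇒B (Gap-down {i = 1} (s≤s z≤n) g)
       , Gap⇒B (Gap-down {i = 2} ≤-refl g) })
  , λ x → mk⇔ (rank≡0⇒Minimal s x ∘ Gap⇒rank≡ s x ∘ B⇒Gap {k = 0})
              (Gap⇒B ∘ rank≡⇒Gap s x ∘ Minimal⇒rank≡0 s x)
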